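{- Let $G$ and $H$ be two graphs with the same principal main eigenvectors (i.e. the set of principal main eigenvectors of $G$ equals that of $H$) but different main eigenvalues (i.e. the set of main eigenvalues of $G$ differs from that of $H$). Then $\mathbf W_G(k)\neq\mathbf W_H(k)$ for all $k\geq 2$.
   Context: All graphs are finite, simple and undirected, with vertex set $\{1,\dots,n\}$; the adjacency matrix $\mathbf A=\mathbf A(G)$ is the symmetric $n\times n$ $(0,1)$-matrix with $(i,j)$ entry $1$ iff $\{i,j\}$ is an edge. Eigenvalues and eigenvectors of $G$ are those of $\mathbf A$. Let $\mathbf j=(1,\dots,1)^T\in\mathbb R^n$. An eigenvalue of $G$ is main if it has an associated eigenvector not orthogonal to $\mathbf j$. For a main eigenvalue $\mu$, with $\mathbf P_\mu$ the orthogonal projection of $\mathbb R^n$ onto the eigenspace $\{\mathbf x\in\mathbb R^n:\mathbf A\mathbf x=\mu\mathbf x\}$, the vector $\mathbf P_\mu\mathbf j$ is the principal main eigenvector corresponding to $\mu$. The $k$-walk matrix $\mathbf W_G(k)$ is the $n\times k$ matrix whose columns are $\mathbf j,\mathbf A\mathbf j,\dots,\mathbf A^{k-1}\mathbf j$. The vertices of the graphs carry fixed labels $1,\dots,n$, and matrices and vectors are compared entrywise. -}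

module Defs where

open import Data.Bool.Base using (if_then_else_)
open import Data.Fin.Base using (Fin; toℕ)
open import Data.Nat.Base as ℕ using (ℕ)
import Data.Nat.Properties as ℕ
open import Data.Nat.GeneralisedArithmetic using (fold)
open import Data.Product.Base using (∃-syntax; _×_; _,_)
open import Data.Sum.Base using (_⊎_)
open import Data.Rational.Base as ℚ using (ℚ; 0ℚ; 1ℚ; ½; ∣_∣; 1/_)
import Data.Rational.Properties as ℚ
open import Data.Rational.Solver using (module +-*-Solver)
open import Data.Vec.Functional using (Vector; foldr; replicate; map; zipWith)
open import Level using (0ℓ)
open import Relation.Binary.Core using (Rel)
open import Relation.Binary.Definitions using (Decidable; Symmetric; Irreflexive)
open import Relation.Binary.PropositionalEquality
  using (_≡_; refl; sym; trans; cong; cong₂; subst)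
open import Relation.Nullary using (¬_; does)
open import Relation.Unary using (Pred; _∈_; _∉_)

-- Real numbers: Cauchy sequences of rationals, compared up to null
-- sequences. _≃_ is the equality of real numbers; _≡_ on ℝ is not used.

Cauchy : (ℕ → ℚ) → Set
Cauchy x = ∀ ε → 0ℚ ℚ.< ε →
  ∃[ N ] (∀ m n → N ℕ.≤ m → N ℕ.≤ n → ∣ x m ℚ.- x n ∣ ℚ.< ε)

record ℝ : Set where
  constructor mkℝ
  field
    seq    : ℕ → ℚ
    cauchy : Cauchy seq

open ℝ public

infix 4 _≃_

_≃_ : Rel ℝ 0ℓ
x ≃ y = ∀ ε → 0ℚ ℚ.< ε →
  ∃[ N ] (∀ n → N ℕ.≤ n → ∣ seq x n ℚ.- seq y n ∣ ℚ.< ε)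

abstract
  half-pos : ∀ ε → 0ℚ ℚ.< ε → 0ℚ ℚ.< ½ ℚ.* ε
  half-pos ε 0<ε = subst (ℚ._< ½ ℚ.* ε) (ℚ.*-zeroʳ ½) (ℚ.*-monoʳ-<-pos ½ 0<ε)

  halves : ∀ ε → ½ ℚ.* ε ℚ.+ ½ ℚ.* ε ≡ ε
  halves ε = trans (sym (ℚ.*-distribʳ-+ ε ½ ½)) (ℚ.*-identityˡ ε)

  const-cauchy : ∀ q → Cauchy (λ _ → q)
  const-cauchy q ε 0<ε = 0 , λ _ _ _ _ →
    subst (ℚ._< ε) (cong ∣_∣ (sym (ℚ.+-inverseʳ q))) 0<ε

  +-cauchy : ∀ x y → Cauchy x → Cauchy y → Cauchy (λ n → x n ℚ.+ y n)
  +-cauchy x y cx cy ε 0<ε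
    with cx (½ ℚ.* ε) (half-pos ε 0<ε) | cy (½ ℚ.* ε) (half-pos ε 0<ε)
  ... | M , hx | N , hy = M ℕ.⊔ N , λ m n p q → begin-strict
    ∣ (x m ℚ.+ y m) ℚ.- (x n ℚ.+ y n) ∣
      ≡⟨ cong ∣_∣ (rearrange (x m) (y m) (x n) (y n)) ⟩
    ∣ (x m ℚ.- x n) ℚ.+ (y m ℚ.- y n) ∣
      ≤⟨ ℚ.∣p+q∣≤∣p∣+∣q∣ (x m ℚ.- x n) (y m ℚ.- y n) ⟩
    ∣ x m ℚ.- x n ∣ ℚ.+ ∣ y m ℚ.- y n ∣
      <⟨ ℚ.+-mono-<
           (hx m n (ℕ.m⊔n≤o⇒m≤o M N p) (ℕ.m⊔n≤o⇒m≤o M N q))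
           (hy m n (ℕ.m⊔n≤o⇒n≤o M N p) (ℕ.m⊔n≤o⇒n≤o M N q)) ⟩
    ½ ℚ.* ε ℚ.+ ½ ℚ.* ε
      ≡⟨ halves ε ⟩
    ε ∎
    where
    open ℚ.≤-Reasoning
    open +-*-Solver
    rearrange : ∀ a b c d →
      (a ℚ.+ b) ℚ.- (c ℚ.+ d) ≡ (a ℚ.- c) ℚ.+ (b ℚ.- d)
    rearrange = solve 4 (λ a b c d →
      (a :+ b) :- (c :+ d) := (a :- c) :+ (b :- d)) refl

  neg-cauchy : ∀ x → Cauchy x → Cauchy (λ n → ℚ.- x n)
  neg-cauchy x cx ε 0<ε with cx ε 0<ε
  ... | N , h = N , λ m n p q →
    subst (ℚ._< ε)
      (trans (sym (ℚ.∣-p∣≡∣p∣ (x m ℚ.- x n)))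
             (cong ∣_∣ (ℚ.neg-distrib-+ (x m) (ℚ.- x n))))
      (h m n p q)

  bounded : ∀ x → Cauchy x →
    ∃[ B ] (0ℚ ℚ.< B × ∃[ N ] (∀ n → N ℕ.≤ n → ∣ x n ∣ ℚ.≤ B))
  bounded x cx with cx 1ℚ (ℚ.positive⁻¹ 1ℚ)
  ... | N , h = ∣ x N ∣ ℚ.+ 1ℚ
              , ℚ.+-mono-≤-< (ℚ.0≤∣p∣ (x N)) (ℚ.positive⁻¹ 1ℚ)
              , N
              , λ n p → begin
    ∣ x n ∣                         ≡⟨ cong ∣_∣ (split (x n) (x N)) ⟩
    ∣ x N ℚ.+ (x n ℚ.- x N) ∣       ≤⟨ ℚ.∣p+q∣≤∣p∣+∣q∣ (x N) (x n ℚ.- x N) ⟩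
    ∣ x N ∣ ℚ.+ ∣ x n ℚ.- x N ∣     ≤⟨ ℚ.+-monoʳ-≤ ∣ x N ∣
                                        (ℚ.<⇒≤ (h n N p ℕ.≤-refl)) ⟩
    ∣ x N ∣ ℚ.+ 1ℚ                  ∎
    where
    open ℚ.≤-Reasoning
    open +-*-Solver
    split : ∀ a b → a ≡ b ℚ.+ (a ℚ.- b)
    split = solve 2 (λ a b → a := b :+ (a :- b)) refl

  shrink : ∀ B → 0ℚ ℚ.< B → ∀ ε → 0ℚ ℚ.< ε →
    ∃[ δ ] (0ℚ ℚ.< δ × B ℚ.* δ ≡ ε)
  shrink B 0<B ε 0<ε = 1/ B ℚ.* ε
    , subst (ℚ._< 1/ B ℚ.* ε) (ℚ.*-zeroʳ (1/ B))
        (ℚ.*-monoʳ-<-pos (1/ B) {{ℚ.1/pos⇒pos B}} 0<ε)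
    , trans (sym (ℚ.*-assoc B (1/ B) ε))
        (trans (cong (ℚ._* ε) (ℚ.*-inverseʳ B)) (ℚ.*-identityˡ ε))
    where
    instance
      B-pos : ℚ.Positive B
      B-pos = ℚ.positive 0<B
      B-nonZero : ℚ.NonZero B
      B-nonZero = ℚ.pos⇒nonZero B

  product-bound : ∀ a b {B δ} → 0ℚ ℚ.< B →
    ∣ a ∣ ℚ.≤ B → ∣ b ∣ ℚ.< δ → ∣ a ℚ.* b ∣ ℚ.< B ℚ.* δ
  product-bound a b {B} {δ} 0<B a≤B b<δ = begin-strict
    ∣ a ℚ.* b ∣        ≡⟨ ℚ.∣p*q∣≡∣p∣*∣q∣ a b ⟩
    ∣ a ∣ ℚ.* ∣ b ∣    ≤⟨ ℚ.*-monoʳ-≤-nonNeg ∣ b ∣ {{ℚ.∣-∣-nonNeg b}} a≤B ⟩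
    B ℚ.* ∣ b ∣        <⟨ ℚ.*-monoʳ-<-pos B {{ℚ.positive 0<B}} b<δ ⟩
    B ℚ.* δ            ∎
    where open ℚ.≤-Reasoning

  *-cauchy : ∀ x y → Cauchy x → Cauchy y → Cauchy (λ n → x n ℚ.* y n)
  *-cauchy x y cx cy ε 0<ε =
    let B , 0<B , K , hB = bounded x cx
        C , 0<C , L , hC = bounded y cy
        δ , 0<δ , Bδ = shrink B 0<B (½ ℚ.* ε) (half-pos ε 0<ε)
        η , 0<η , Cη = shrink C 0<C (½ ℚ.* ε) (half-pos ε 0<ε)
        M , hy = cy δ 0<δ
        N , hx = cx η 0<η
    in (K ℕ.⊔ L) ℕ.⊔ (M ℕ.⊔ N) , λ m n p q →
    let K≤m = ℕ.m⊔n≤o⇒m≤o K L (ℕ.m⊔n≤o⇒m≤o (K ℕ.⊔ L) (M ℕ.⊔ N) p)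
        L≤n = ℕ.m⊔n≤o⇒n≤o K L (ℕ.m⊔n≤o⇒m≤o (K ℕ.⊔ L) (M ℕ.⊔ N) q)
        MN≤m = ℕ.m⊔n≤o⇒n≤o (K ℕ.⊔ L) (M ℕ.⊔ N) p
        MN≤n = ℕ.m⊔n≤o⇒n≤o (K ℕ.⊔ L) (M ℕ.⊔ N) q
    in begin-strict
    ∣ x m ℚ.* y m ℚ.- x n ℚ.* y n ∣
      ≡⟨ cong ∣_∣ (rearrange (x m) (y m) (x n) (y n)) ⟩
    ∣ x m ℚ.* (y m ℚ.- y n) ℚ.+ y n ℚ.* (x m ℚ.- x n) ∣
      ≤⟨ ℚ.∣p+q∣≤∣p∣+∣q∣ (x m ℚ.* (y m ℚ.- y n)) (y n ℚ.* (x m ℚ.- x n)) ⟩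
    ∣ x m ℚ.* (y m ℚ.- y n) ∣ ℚ.+ ∣ y n ℚ.* (x m ℚ.- x n) ∣
      <⟨ ℚ.+-mono-<
           (product-bound (x m) (y m ℚ.- y n) 0<B (hB m K≤m)
             (hy m n (ℕ.m⊔n≤o⇒m≤o M N MN≤m) (ℕ.m⊔n≤o⇒m≤o M N MN≤n)))
           (product-bound (y n) (x m ℚ.- x n) 0<C (hC n L≤n)
             (hx m n (ℕ.m⊔n≤o⇒n≤o M N MN≤m) (ℕ.m⊔n≤o⇒n≤o M N MN≤n))) ⟩
    B ℚ.* δ ℚ.+ C ℚ.* η
      ≡⟨ cong₂ ℚ._+_ Bδ Cη ⟩
    ½ ℚ.* ε ℚ.+ ½ ℚ.* ε
      ≡⟨ halves ε ⟩
    ε ∎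
    where
    open ℚ.≤-Reasoning
    open +-*-Solver
    rearrange : ∀ a b c d →
      a ℚ.* b ℚ.- c ℚ.* d ≡ a ℚ.* (b ℚ.- d) ℚ.+ d ℚ.* (a ℚ.- c)
    rearrange = solve 4 (λ a b c d →
      a :* b :- c :* d := a :* (b :- d) :+ d :* (a :- c)) refl

fromℚ : ℚ → ℝ
fromℚ q = mkℝ (λ _ → q) (const-cauchy q)

0ℝ 1ℝ : ℝ
0ℝ = fromℚ 0ℚ
1ℝ = fromℚ 1ℚ

infixl 6 _+_ _-_
infixl 7 _*_
infix  8 -_

_+_ : ℝ → ℝ → ℝ
x + y = mkℝ (λ n → seq x n ℚ.+ seq y n) (+-cauchy (seq x) (seq y) (cauchy x) (cauchy y))

_*_ : ℝ → ℝ → ℝ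
x * y = mkℝ (λ n → seq x n ℚ.* seq y n) (*-cauchy (seq x) (seq y) (cauchy x) (cauchy y))

-_ : ℝ → ℝ
- x = mkℝ (λ n → ℚ.- seq x n) (neg-cauchy (seq x) (cauchy x))

_-_ : ℝ → ℝ → ℝ
x - y = x + (- y)

Matrix : ℕ → ℕ → Set
Matrix m n = Fin m → Fin n → ℝ

infix 4 _≃ᵛ_ _≃ᵐ_

_≃ᵛ_ : ∀ {n} → Rel (Vector ℝ n) 0ℓ
x ≃ᵛ y = ∀ i → x i ≃ y i

_≃ᵐ_ : ∀ {m n} → Rel (Matrix m n) 0ℓ
A ≃ᵐ B = ∀ i j → A i j ≃ B i j

⟨_,_⟩ : ∀ {n} → Vector ℝ n → Vector ℝ n → ℝ
⟨ x , y ⟩ = foldr _+_ 0ℝ (zipWith _*_ x y)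

infixr 7 _·_ _•_

_·_ : ∀ {m n} → Matrix m n → Vector ℝ n → Vector ℝ m
(A · x) i = ⟨ A i , x ⟩

_•_ : ∀ {n} → ℝ → Vector ℝ n → Vector ℝ n
c • x = map (c *_) x

infixl 6 _-ᵛ_

_-ᵛ_ : ∀ {n} → Vector ℝ n → Vector ℝ n → Vector ℝ n
x -ᵛ y = zipWith _-_ x y

𝟎 𝐣 : ∀ {n} → Vector ℝ n
𝟎 {n} = replicate n 0ℝ
𝐣 {n} = replicate n 1ℝ

infix 4 _⊥ᵛ_

_⊥ᵛ_ : ∀ {n} → Rel (Vector ℝ n) 0ℓ
x ⊥ᵛ y = ⟨ x , y ⟩ ≃ 0ℝ

-- P x = p, for P the orthogonal projection onto the subspace S, as a relation.
IsProjection : ∀ {n} → Pred (Vector ℝ n) 0ℓ → Vector ℝ n → Vector ℝ n → Set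
IsProjection S x p = p ∈ S × (∀ s → s ∈ S → (x -ᵛ p) ⊥ᵛ s)

Eigenspace : ∀ {n} → Matrix n n → ℝ → Pred (Vector ℝ n) 0ℓ
Eigenspace A μ x = A · x ≃ᵛ μ • x

IsEigenvector : ∀ {n} → Matrix n n → ℝ → Pred (Vector ℝ n) 0ℓ
IsEigenvector A μ x = ¬ (x ≃ᵛ 𝟎) × x ∈ Eigenspace A μ

record Graph (n : ℕ) : Set₁ where
  field
    _~_      : Rel (Fin n) 0ℓ
    ~-sym    : Symmetric _~_
    ~-irrefl : Irreflexive _≡_ _~_
    _~?_     : Decidable _~_

adjacencyMatrix : ∀ {n} → Graph n → Matrix n n
adjacencyMatrix G i j = if does (i ~? j) then 1ℝ else 0ℝ
  where open Graph G

MainEigenvalue : ∀ {n} → Graph n → Pred ℝ 0ℓ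
MainEigenvalue G μ = ∃[ x ] (x ∈ IsEigenvector (adjacencyMatrix G) μ × ¬ (x ⊥ᵛ 𝐣))

PrincipalMainEigenvector : ∀ {n} → Graph n → Pred (Vector ℝ n) 0ℓ
PrincipalMainEigenvector G v =
  ∃[ μ ] (μ ∈ MainEigenvalue G × IsProjection (Eigenspace (adjacencyMatrix G) μ) 𝐣 v)

-- Column l, counted from 0, is Aˡ 𝐣.
walkMatrix : ∀ {n} → Graph n → (k : ℕ) → Matrix n k
walkMatrix G k i l = fold 𝐣 (adjacencyMatrix G ·_) (toℕ l) i

-- Some element belongs to exactly one of the two sets.  Classically this
-- is the negation of P ≐ Q.
Differ : {A : Set} → Pred A 0ℓ → Pred A 0ℓ → Set
Differ P Q = ∃[ x ] ((x ∈ P × x ∉ Q) ⊎ (x ∉ P × x ∈ Q))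

{-# OPTIONS --safe #-}

-- Let μ be a main eigenvalue of G with principal main eigenvector v, which is
-- also the principal main eigenvector of H for some main eigenvalue ν.  If the
-- walk matrices agree then A 𝐣 = B 𝐣 for the adjacency matrices A and B, so
--   μ ⟨v, 𝐣⟩ = ⟨A v, 𝐣⟩ = ⟨v, A 𝐣⟩ = ⟨v, B 𝐣⟩ = ⟨B v, 𝐣⟩ = ν ⟨v, 𝐣⟩,
-- and ⟨v, 𝐣⟩ = ⟨v, v⟩ ≠ 0 forces μ = ν, whence μ is a main eigenvalue of H.
-- As the conclusion is a negation, it suffices that orthogonal projections exist up
-- to double negation, and case distinctions on real numbers are available.

module Submission where

open import Algebra.Bundles using (CommutativeRing)
open import Algebra.Definitions using (Congruent₁; Congruent₂)
import Algebra.Properties.Ring as RingProperties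
import Algebra.Properties.Semiring.Sum as Sum
open import Data.Fin.Base using (Fin; zero; suc)
open import Data.Nat.Base as ℕ using (ℕ; zero; suc; _≤_; s≤s)
import Data.Nat.Properties as ℕ
open import Data.Product.Base using (∃-syntax; _×_; _,_; proj₁; proj₂)
open import Data.Rational.Base as ℚ using (ℚ; 0ℚ; 1ℚ; ½; ∣_∣; 1/_)
import Data.Rational.Properties as ℚ
open import Data.Rational.Solver using (module +-*-Solver)
open import Data.Sum.Base using (_⊎_; inj₁; inj₂)
open import Data.Vec.Functional using (Vector; _∷_; tail)
open import Defs
open import Function.Base using (_∘_)
open import Level using (0ℓ; _⊔_)
import Relation.Binary.Reasoning.Setoid as SetoidReasoning
open import Relation.Binary.PropositionalEquality
  using (_≡_; _≢_; refl; sym; trans; cong; cong₂; subst)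
open import Relation.Nullary using (¬_; yes; no; ¬¬-excluded-middle)
open import Relation.Nullary.Negation using (contradiction)
open import Relation.Unary using (Pred; _∈_; _∉_; _≐_)

-- Linear algebra over a commutative ring.

module LinearAlgebra {c ℓ} (R : CommutativeRing c ℓ) where

  open CommutativeRing R renaming
    (Carrier to K; _+_ to _⊞_; _*_ to _⊠_; -_ to ⊟_; _-_ to _⊟_;
     refl to ≈-refl; sym to ≈-sym; trans to ≈-trans; zero to ≈-zero)
  open RingProperties ring using (-‿distribˡ-*; +-cancelʳ)
  open Sum semiring
  open SetoidReasoning setoid

  infixl 6 _⊟ᵛ_
  infixr 7 _⊡_

  dot : ∀ {n} → Vector K n → Vector K n → K
  dot x y = sum (λ i → x i ⊠ y i)

  -- Differences are treated as combinations with coefficients `1#` and `⊟ 1#`, so that one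
  -- bilinearity law covers scaling, sums and subtraction.
  combination : ∀ {n} → K → Vector K n → K → Vector K n → Vector K n
  combination a x b y i = a ⊠ x i ⊞ b ⊠ y i

  _⊟ᵛ_ : ∀ {n} → Vector K n → Vector K n → Vector K n
  (x ⊟ᵛ y) i = x i ⊟ y i

  dot-cong : ∀ {n} {x x′ y y′ : Vector K n} →
    (∀ i → x i ≈ x′ i) → (∀ i → y i ≈ y′ i) → dot x y ≈ dot x′ y′
  dot-cong x≈x′ y≈y′ = sum-cong-≋ (λ i → *-cong (x≈x′ i) (y≈y′ i))

  dot-comm : ∀ {n} (x y : Vector K n) → dot x y ≈ dot y x
  dot-comm x y = sum-cong-≋ (λ i → *-comm (x i) (y i))

  dot-combinationˡ : ∀ {n} a (x : Vector K n) b y z →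
    dot (combination a x b y) z ≈ a ⊠ dot x z ⊞ b ⊠ dot y z
  dot-combinationˡ a x b y z = begin
    dot (combination a x b y) z
      ≈⟨ sum-cong-≋ (λ i → ≈-trans (distribʳ (z i) (a ⊠ x i) (b ⊠ y i))
           (+-cong (*-assoc a (x i) (z i)) (*-assoc b (y i) (z i)))) ⟩
    sum (λ i → a ⊠ (x i ⊠ z i) ⊞ b ⊠ (y i ⊠ z i))
      ≈⟨ ∑-distrib-+ (λ i → a ⊠ (x i ⊠ z i)) (λ i → b ⊠ (y i ⊠ z i)) ⟩
    sum (λ i → a ⊠ (x i ⊠ z i)) ⊞ sum (λ i → b ⊠ (y i ⊠ z i))
      ≈⟨ +-cong (*-distribˡ-sum a (λ i → x i ⊠ z i))
                (*-distribˡ-sum b (λ i → y i ⊠ z i)) ⟨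
    a ⊠ dot x z ⊞ b ⊠ dot y z ∎

  dot-combinationʳ : ∀ {n} a (x : Vector K n) b y z →
    dot z (combination a x b y) ≈ a ⊠ dot z x ⊞ b ⊠ dot z y
  dot-combinationʳ a x b y z = begin
    dot z (combination a x b y)  ≈⟨ dot-comm z (combination a x b y) ⟩
    dot (combination a x b y) z  ≈⟨ dot-combinationˡ a x b y z ⟩
    a ⊠ dot x z ⊞ b ⊠ dot y z    ≈⟨ +-cong (*-congˡ (dot-comm x z))
                                           (*-congˡ (dot-comm y z)) ⟩
    a ⊠ dot z x ⊞ b ⊠ dot z y    ∎

  cancels : ∀ {a b} → a ≈ b → 1# ⊠ a ⊞ (⊟ 1#) ⊠ b ≈ 0#
  cancels {a} {b} a≈b = begin
    1# ⊠ a ⊞ (⊟ 1#) ⊠ b  ≈⟨ +-congʳ (*-congˡ a≈b) ⟩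
    1# ⊠ b ⊞ (⊟ 1#) ⊠ b  ≈⟨ distribʳ b 1# (⊟ 1#) ⟨
    (1# ⊟ 1#) ⊠ b        ≈⟨ *-congʳ (-‿inverseʳ 1#) ⟩
    0# ⊠ b               ≈⟨ zeroˡ b ⟩
    0#                   ∎

  ⊟-combination : ∀ a b → a ⊟ b ≈ 1# ⊠ a ⊞ (⊟ 1#) ⊠ b
  ⊟-combination a b = +-cong (≈-sym (*-identityˡ a))
    (≈-trans (-‿cong (≈-sym (*-identityˡ b))) (-‿distribˡ-* 1# b))

  dot-⊟ᵛ≈0 : ∀ {n} (x y z : Vector K n) →
    dot x z ≈ dot y z → dot (x ⊟ᵛ y) z ≈ 0#
  dot-⊟ᵛ≈0 x y z xz≈yz = begin
    dot (x ⊟ᵛ y) z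
      ≈⟨ dot-cong (λ i → ⊟-combination (x i) (y i)) (λ _ → ≈-refl) ⟩
    dot (combination 1# x (⊟ 1#) y) z
      ≈⟨ dot-combinationˡ 1# x (⊟ 1#) y z ⟩
    1# ⊠ dot x z ⊞ (⊟ 1#) ⊠ dot y z
      ≈⟨ cancels xz≈yz ⟩
    0# ∎

  dot-zeroˡ : ∀ {n} {x : Vector K n} y → (∀ i → x i ≈ 0#) → dot x y ≈ 0#
  dot-zeroˡ {n} y x≈0 = ≈-trans
    (sum-cong-≋ (λ i → ≈-trans (*-congʳ (x≈0 i)) (zeroˡ (y i))))
    (sum-replicate-zero n)

  dot-tailʳ : ∀ {n} (x y : Vector K (suc n)) →
    y zero ≈ 0# → dot x y ≈ dot (tail x) (tail y)
  dot-tailʳ x y y₀≈0 = begin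
    x zero ⊠ y zero ⊞ dot (tail x) (tail y)
      ≈⟨ +-congʳ (≈-trans (*-congˡ y₀≈0) (zeroʳ (x zero))) ⟩
    0# ⊞ dot (tail x) (tail y)  ≈⟨ +-identityˡ (dot (tail x) (tail y)) ⟩
    dot (tail x) (tail y)       ∎

  _⊡_ : ∀ {m n} → (Fin m → Fin n → K) → Vector K n → Vector K m
  (A ⊡ x) i = dot (A i) x

  Symm : ∀ {n} → (Fin n → Fin n → K) → Set ℓ
  Symm A = ∀ i j → A i j ≈ A j i

  -- Both sides are the double sum of `A i j ⊠ x j ⊠ y i`, up to the order of summation and symmetry
  -- of `A`.
  self-adjoint : ∀ {n} {A : Fin n → Fin n → K} → Symm A →
    ∀ x y → dot (A ⊡ x) y ≈ dot x (A ⊡ y)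
  self-adjoint {A = A} A-symm x y = begin
    sum (λ i → dot (A i) x ⊠ y i)
      ≈⟨ sum-cong-≋ (λ i → *-distribʳ-sum (y i) (λ j → A i j ⊠ x j)) ⟩
    sum (λ i → sum (λ j → A i j ⊠ x j ⊠ y i))
      ≈⟨ ∑-comm (λ i j → A i j ⊠ x j ⊠ y i) ⟩
    sum (λ j → sum (λ i → A i j ⊠ x j ⊠ y i))
      ≈⟨ sum-cong-≋ (λ j → sum-cong-≋ (λ i → begin
           A i j ⊠ x j ⊠ y i    ≈⟨ *-congʳ (*-congʳ (A-symm i j)) ⟩
           A j i ⊠ x j ⊠ y i    ≈⟨ *-congʳ (*-comm (A j i) (x j)) ⟩
           x j ⊠ A j i ⊠ y i    ≈⟨ *-assoc (x j) (A j i) (y i) ⟩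
           x j ⊠ (A j i ⊠ y i)  ∎)) ⟩
    sum (λ j → sum (λ i → x j ⊠ (A j i ⊠ y i)))
      ≈⟨ sum-cong-≋ (λ j → *-distribˡ-sum (x j) (λ i → A j i ⊠ y i)) ⟨
    sum (λ j → x j ⊠ dot (A j) y) ∎

  -- The positive form of being nonzero: the inverse is given as data, which is what cancellation
  -- uses.
  Invertible : K → Set (c ⊔ ℓ)
  Invertible a = ∃[ b ] (b ⊠ a ≈ 1#)

  cancelˡ : ∀ {a x y} → Invertible a → a ⊠ x ≈ a ⊠ y → x ≈ y
  cancelˡ {a} {x} {y} (b , ba≈1) ax≈ay = begin
    x            ≈⟨ undo x ⟨
    b ⊠ (a ⊠ x)  ≈⟨ *-congˡ ax≈ay ⟩
    b ⊠ (a ⊠ y)  ≈⟨ undo y ⟩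
    y            ∎
    where
    undo : ∀ z → b ⊠ (a ⊠ z) ≈ z
    undo z = begin
      b ⊠ (a ⊠ z)  ≈⟨ *-assoc b a z ⟨
      b ⊠ a ⊠ z    ≈⟨ *-congʳ ba≈1 ⟩
      1# ⊠ z       ≈⟨ *-identityˡ z ⟩
      z            ∎

  -- By `expand`, pairing `v` with the common image of `j` equals both `μ ⊠ dot v j` and
  -- `ν ⊠ dot v j`; then `dot v j` is cancelled.
  shared-eigenvector : ∀ {n} {A B : Fin n → Fin n → K} {μ ν} {j v} →
    Symm A → Symm B → (∀ i → (A ⊡ j) i ≈ (B ⊡ j) i) →
    (∀ i → (A ⊡ v) i ≈ μ ⊠ v i) → (∀ i → (B ⊡ v) i ≈ ν ⊠ v i) →
    Invertible (dot v j) → μ ≈ ν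
  shared-eigenvector {A = A} {B} {μ} {ν} {j} {v} A-symm B-symm Aj≈Bj Av≈μv Bv≈νv inv =
    cancelˡ inv (begin
      dot v j ⊠ μ    ≈⟨ *-comm (dot v j) μ ⟩
      μ ⊠ dot v j    ≈⟨ expand A-symm Av≈μv ⟩
      dot v (A ⊡ j)  ≈⟨ dot-cong {x = v} (λ _ → ≈-refl) Aj≈Bj ⟩
      dot v (B ⊡ j)  ≈⟨ expand B-symm Bv≈νv ⟨
      ν ⊠ dot v j    ≈⟨ *-comm ν (dot v j) ⟩
      dot v j ⊠ ν    ∎)
    where
    expand : ∀ {C κ} → Symm C → (∀ i → (C ⊡ v) i ≈ κ ⊠ v i) →
      κ ⊠ dot v j ≈ dot v (C ⊡ j)
    expand {C} {κ} C-symm Cv≈κv = begin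
      κ ⊠ dot v j
        ≈⟨ *-distribˡ-sum κ (λ i → v i ⊠ j i) ⟩
      sum (λ i → κ ⊠ (v i ⊠ j i))
        ≈⟨ sum-cong-≋ (λ i → *-assoc κ (v i) (j i)) ⟨
      dot (λ i → κ ⊠ v i) j
        ≈⟨ dot-cong {y = j} Cv≈κv (λ _ → ≈-refl) ⟨
      dot (C ⊡ v) j
        ≈⟨ self-adjoint C-symm v j ⟩
      dot v (C ⊡ j) ∎

  -- Subspaces and eigenspaces.

  -- An arbitrary predicate need not respect pointwise `≈`, so `resp` demands it; it is what allows
  -- a vector with first coordinate `≈ 0#` to be replaced by `0# ∷` its tail.
  record IsSubspace {n p} (S : Pred (Vector K n) p) : Set (c ⊔ ℓ ⊔ p) where
    field
      resp   : ∀ {x y} → (∀ i → x i ≈ y i) → x ∈ S → y ∈ S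
      zero∈  : (λ _ → 0#) ∈ S
      closed : ∀ a {x} b {y} → x ∈ S → y ∈ S → combination a x b y ∈ S

  eigenspace-isSubspace : ∀ {n} (A : Fin n → Fin n → K) μ →
    IsSubspace (λ x → ∀ i → (A ⊡ x) i ≈ μ ⊠ x i)
  eigenspace-isSubspace {n} A μ = record
    { resp = λ {x} {y} x≈y Ax≈μx i → begin
        dot (A i) y  ≈⟨ dot-cong {x = A i} (λ _ → ≈-refl) x≈y ⟨
        dot (A i) x  ≈⟨ Ax≈μx i ⟩
        μ ⊠ x i      ≈⟨ *-congˡ (x≈y i) ⟩
        μ ⊠ y i      ∎
    ; zero∈ = λ i → begin
        dot (A i) (λ _ → 0#)  ≈⟨ dot-comm (A i) (λ _ → 0#) ⟩
        dot (λ _ → 0#) (A i)  ≈⟨ dot-zeroˡ (A i) (λ _ → ≈-refl) ⟩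
        0#                    ≈⟨ zeroʳ μ ⟨
        μ ⊠ 0#                ∎
    ; closed = λ a {x} b {y} Ax≈μx Ay≈μy i → begin
        dot (A i) (combination a x b y)
          ≈⟨ dot-combinationʳ a x b y (A i) ⟩
        a ⊠ dot (A i) x ⊞ b ⊠ dot (A i) y
          ≈⟨ +-cong (swap a (Ax≈μx i)) (swap b (Ay≈μy i)) ⟩
        μ ⊠ (a ⊠ x i) ⊞ μ ⊠ (b ⊠ y i)
          ≈⟨ distribˡ μ (a ⊠ x i) (b ⊠ y i) ⟨
        μ ⊠ (a ⊠ x i ⊞ b ⊠ y i) ∎
    }
    where
    swap : ∀ a {d z} → d ≈ μ ⊠ z → a ⊠ d ≈ μ ⊠ (a ⊠ z)
    swap a {d} {z} d≈μz = begin
      a ⊠ d        ≈⟨ *-congˡ d≈μz ⟩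
      a ⊠ (μ ⊠ z)  ≈⟨ *-assoc a μ z ⟨
      a ⊠ μ ⊠ z    ≈⟨ *-congʳ (*-comm a μ) ⟩
      μ ⊠ a ⊠ z    ≈⟨ *-assoc μ a z ⟩
      μ ⊠ (a ⊠ z)  ∎

  -- Orthogonal projections, up to double negation.

  -- The two parameters are the properties of the reals behind Gram-Schmidt: an element without
  -- inverse is zero, and the dot product is definite.
  module Projection
    (noninvertible⇒≈0 : ∀ {a} → ¬ Invertible a → a ≈ 0#)
    (dot-definite : ∀ {n} (x : Vector K n) → dot x x ≈ 0# → ∀ i → x i ≈ 0#)
    where

    -- Orthogonality of `x ⊟ᵛ p` to `S` is phrased as an equality of dot products, which chains
    -- better; `dot-⊟ᵛ≈0` converts it back.
    HasProjection : ∀ {n p} → Pred (Vector K n) p → Vector K n → Set (c ⊔ ℓ ⊔ p)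
    HasProjection S x = ∃[ p ] (p ∈ S × (∀ s → s ∈ S → dot p s ≈ dot x s))

    -- If `dot x x` had no inverse it would be zero, hence `x i ≈ 0#` by definiteness. With `x i`
    -- invertible this gives `0# ≈ 1#`, so `dot x x ≈ 1#` would be invertible after all.
    invertible-dot-self : ∀ {n} (x : Vector K n) i →
      Invertible (x i) → ¬ ¬ Invertible (dot x x)
    invertible-dot-self x i (b , bx≈1) ¬inv = ¬inv (1# , (begin
      1# ⊠ dot x x  ≈⟨ *-identityˡ (dot x x) ⟩
      dot x x       ≈⟨ xx≈0 ⟩
      0#            ≈⟨ zeroʳ b ⟨
      b ⊠ 0#        ≈⟨ *-congˡ (dot-definite x xx≈0 i) ⟨
      b ⊠ x i       ≈⟨ bx≈1 ⟩
      1#            ∎))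
      where xx≈0 = noninvertible⇒≈0 ¬inv

    -- The part of `S` in the hyperplane of vanishing first coordinate, seen one dimension lower:
    -- the vehicle of the induction on `n`.
    Slice : ∀ {n p} → Pred (Vector K (suc n)) p → Pred (Vector K n) p
    Slice S x = (0# ∷ x) ∈ S

    slice-isSubspace : ∀ {n p} {S : Pred (Vector K (suc n)) p} →
      IsSubspace S → IsSubspace (Slice S)
    slice-isSubspace {S = S} S-subspace = record
      { resp = λ x≈y → resp λ { zero → ≈-refl ; (suc i) → x≈y i }
      ; zero∈ = resp (λ { zero → ≈-refl ; (suc i) → ≈-refl }) zero∈
      ; closed = λ a b x∈ y∈ → resp
          (λ { zero → ≈-trans (+-cong (zeroʳ a) (zeroʳ b)) (+-identityˡ 0#)
             ; (suc i) → ≈-refl })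
          (closed a b x∈ y∈)
      }
      where open IsSubspace S-subspace

    tail∈slice : ∀ {n p} {S : Pred (Vector K (suc n)) p} → IsSubspace S →
      ∀ {x} → x zero ≈ 0# → x ∈ S → tail x ∈ Slice S
    tail∈slice S-subspace x₀≈0 = resp λ { zero → x₀≈0 ; (suc i) → ≈-refl }
      where open IsSubspace S-subspace

    -- One Gram–Schmidt step: a vector of S with invertible first coordinate
    -- is made orthogonal to the slice and spans S together with it.
    extend-projection : ∀ {n p} {S : Pred (Vector K (suc n)) p} → IsSubspace S →
      ∀ {t} → t ∈ S → Invertible (t zero) → HasProjection (Slice S) (tail t) →
      ∀ x → HasProjection (Slice S) (tail x) → ¬ ¬ HasProjection S x
    extend-projection {n} {S = S} S-subspace {t} t∈S t₀-inv (q , q∈ , q-proj) x (r , r∈ , r-proj) ¬proj =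
      -- The inverse `d` of `dot t′ t′` is available only up to double negation, which is harmless
      -- since the goal here is a contradiction.
      invertible-dot-self t′ zero t′₀-inv λ where
        (d , d-inv) → ¬proj
          ( p d
          , closed (d ⊠ dot x t′) 1# t′∈S r∈
          , λ s s∈ → p-proj d d-inv s s∈)
      where
      open IsSubspace S-subspace

      -- `t` minus its projection `q` onto the slice; the first coordinate stays that of `t`.
      t′ : Vector K (suc n)
      t′ = combination 1# t (⊟ 1#) (0# ∷ q)

      t′∈S : t′ ∈ S
      t′∈S = closed 1# (⊟ 1#) t∈S q∈

      t′₀≈t₀ : t′ zero ≈ t zero
      t′₀≈t₀ = begin
        1# ⊠ t zero ⊞ (⊟ 1#) ⊠ 0#  ≈⟨ +-cong (*-identityˡ (t zero)) (zeroʳ (⊟ 1#)) ⟩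
        t zero ⊞ 0#                ≈⟨ +-identityʳ (t zero) ⟩
        t zero                     ∎

      t′₀-inv : Invertible (t′ zero)
      t′₀-inv = proj₁ t₀-inv , ≈-trans (*-congˡ t′₀≈t₀) (proj₂ t₀-inv)

      t′⊥slice : ∀ s → s ∈ Slice S → dot (tail t′) s ≈ 0#
      t′⊥slice s s∈ = ≈-trans (dot-combinationˡ 1# (tail t) (⊟ 1#) q s)
        (cancels (≈-sym (q-proj s s∈)))

      -- With `d` the inverse of `dot t′ t′`, this is the component of `x` along `t′` plus the
      -- projection `r` of `x` onto the slice.
      p : K → Vector K (suc n)
      p d = combination (d ⊠ dot x t′) t′ 1# (0# ∷ r)

      module _ (d : K) (d-inv : d ⊠ dot t′ t′ ≈ 1#) where

        c′ : K
        c′ = d ⊠ dot x t′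

        p-proj-t′ : dot (p d) t′ ≈ dot x t′
        p-proj-t′ = begin
          dot (p d) t′
            ≈⟨ dot-combinationˡ c′ t′ 1# (0# ∷ r) t′ ⟩
          c′ ⊠ dot t′ t′ ⊞ 1# ⊠ dot (0# ∷ r) t′
            ≈⟨ +-cong
                 (≈-trans (*-congʳ (*-comm d (dot x t′)))
                          (*-assoc (dot x t′) d (dot t′ t′)))
                 (*-identityˡ (dot (0# ∷ r) t′)) ⟩
          dot x t′ ⊠ (d ⊠ dot t′ t′) ⊞ dot (0# ∷ r) t′
            ≈⟨ +-cong
                 (≈-trans (*-congˡ d-inv) (*-identityʳ (dot x t′)))
                 (≈-trans (dot-comm (0# ∷ r) t′)
                   (≈-trans (dot-tailʳ t′ (0# ∷ r) ≈-refl) (t′⊥slice r r∈))) ⟩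
          dot x t′ ⊞ 0#
            ≈⟨ +-identityʳ (dot x t′) ⟩
          dot x t′ ∎

        p-proj-slice : ∀ s → s ∈ Slice S → dot (tail (p d)) s ≈ dot (tail x) s
        p-proj-slice s s∈ = begin
          dot (tail (p d)) s
            ≈⟨ dot-combinationˡ c′ (tail t′) 1# r s ⟩
          c′ ⊠ dot (tail t′) s ⊞ 1# ⊠ dot r s
            ≈⟨ +-cong
                 (≈-trans (*-congˡ (t′⊥slice s s∈)) (zeroʳ c′))
                 (≈-trans (*-identityˡ (dot r s)) (r-proj s s∈)) ⟩
          0# ⊞ dot (tail x) s
            ≈⟨ +-identityˡ (dot (tail x) s) ⟩
          dot (tail x) s ∎

        p-proj : ∀ s → s ∈ S → dot (p d) s ≈ dot x s
        -- The vector `w`, which is `t zero` times `s` minus `s zero` times `t′`, has first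
        -- coordinate zero, so its tail is in the slice. As `p d` and `x` pair equally with the
        -- slice and with `t′`, they pair equally with `t zero` times `s`, and `t zero` cancels.
        p-proj s s∈ = cancelˡ t₀-inv
          (+-cancelʳ (⊟ s zero ⊠ dot x t′) (t zero ⊠ dot (p d) s) (t zero ⊠ dot x s) (begin
            t zero ⊠ dot (p d) s ⊞ ⊟ s zero ⊠ dot x t′
              ≈⟨ +-congˡ (*-congˡ p-proj-t′) ⟨
            t zero ⊠ dot (p d) s ⊞ ⊟ s zero ⊠ dot (p d) t′
              ≈⟨ dot-combinationʳ (t zero) s (⊟ s zero) t′ (p d) ⟨
            dot (p d) w
              ≈⟨ dot-tailʳ (p d) w w₀≈0 ⟩
            dot (tail (p d)) (tail w)
              ≈⟨ p-proj-slice (tail w) (tail∈slice S-subspace w₀≈0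
                   (closed (t zero) (⊟ s zero) s∈ t′∈S)) ⟩
            dot (tail x) (tail w)
              ≈⟨ dot-tailʳ x w w₀≈0 ⟨
            dot x w
              ≈⟨ dot-combinationʳ (t zero) s (⊟ s zero) t′ x ⟩
            t zero ⊠ dot x s ⊞ ⊟ s zero ⊠ dot x t′ ∎))
          where
          w : Vector K (suc n)
          w = combination (t zero) s (⊟ s zero) t′

          w₀≈0 : w zero ≈ 0#
          w₀≈0 = begin
            t zero ⊠ s zero ⊞ ⊟ s zero ⊠ t′ zero
              ≈⟨ +-cong (*-comm (t zero) (s zero)) (*-congˡ t′₀≈t₀) ⟩
            s zero ⊠ t zero ⊞ ⊟ s zero ⊠ t zero
              ≈⟨ distribʳ (t zero) (s zero) (⊟ s zero) ⟨
            (s zero ⊟ s zero) ⊠ t zero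
              ≈⟨ *-congʳ (-‿inverseʳ (s zero)) ⟩
            0# ⊠ t zero
              ≈⟨ zeroˡ (t zero) ⟩
            0# ∎

    -- Induction on `n` through the slice. Either some member of `S` has an invertible first
    -- coordinate and `extend-projection` applies, or `S` is just the slice padded with zero.
    projection-exists : ∀ {n p} {S : Pred (Vector K n) p} → IsSubspace S →
      ∀ x → ¬ ¬ HasProjection S x
    projection-exists {zero} S-subspace x ¬proj =
      ¬proj ((λ _ → 0#) , IsSubspace.zero∈ S-subspace , λ _ _ → ≈-refl)
    projection-exists {suc n} {S = S} S-subspace x ¬proj =
      projection-exists sliceS (tail x) λ (r , r∈ , r-proj) →
      -- This existence question is not decidable in general, but the goal is a contradiction, so
      -- excluded middle may be used.
      ¬¬-excluded-middle {A = ∃[ t ] (t ∈ S × Invertible (t zero))} λ where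
        (yes (t , t∈S , t₀-inv)) →
          projection-exists sliceS (tail t) λ t-proj →
          extend-projection S-subspace t∈S t₀-inv t-proj x (r , r∈ , r-proj) ¬proj
        (no none) →
          let s₀≈0 = λ s s∈ → noninvertible⇒≈0 {s zero} λ inv → none (s , s∈ , inv)
          in ¬proj (0# ∷ r , r∈ , λ s s∈ → begin
            dot (0# ∷ r) s         ≈⟨ dot-tailʳ (0# ∷ r) s (s₀≈0 s s∈) ⟩
            dot r (tail s)         ≈⟨ r-proj (tail s) (tail∈slice S-subspace (s₀≈0 s s∈) s∈) ⟩
            dot (tail x) (tail s)  ≈⟨ dot-tailʳ x s (s₀≈0 s s∈) ⟨
            dot x s                ∎)
      where sliceS = slice-isSubspace S-subspace

-- The commutative ring of Cauchy reals.

-- Operations on reals act term by term, so through this lemma most ring laws come from those of the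
-- rationals.
≡⇒≃ : ∀ x y → (∀ n → seq x n ≡ seq y n) → x ≃ y
≡⇒≃ x y x≡y ε 0<ε = 0 , λ n _ → subst (ℚ._< ε)
  (cong ∣_∣ (trans (sym (ℚ.+-inverseʳ (seq y n))) (cong (ℚ._- seq y n) (sym (x≡y n)))))
  0<ε

≃-refl : ∀ {x} → x ≃ x
≃-refl {x} = ≡⇒≃ x x (λ _ → refl)

≃-sym : ∀ {x y} → x ≃ y → y ≃ x
≃-sym {x} {y} x≃y ε 0<ε =
  let N , h = x≃y ε 0<ε
  in N , λ n N≤n → subst (ℚ._< ε) (∣p-q∣≡∣q-p∣ (seq x n) (seq y n)) (h n N≤n)
  where
  open +-*-Solver
  ∣p-q∣≡∣q-p∣ : ∀ p q → ∣ p ℚ.- q ∣ ≡ ∣ q ℚ.- p ∣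
  ∣p-q∣≡∣q-p∣ p q = trans (sym (ℚ.∣-p∣≡∣p∣ (p ℚ.- q)))
    (cong ∣_∣ (solve 2 (λ p q → :- (p :- q) := q :- p) refl p q))

≃-trans : ∀ {x y z} → x ≃ y → y ≃ z → x ≃ z
≃-trans {x} {y} {z} x≃y y≃z ε 0<ε =
  let M , h = x≃y (½ ℚ.* ε) (half-pos ε 0<ε)
      N , k = y≃z (½ ℚ.* ε) (half-pos ε 0<ε)
  in M ℕ.⊔ N , λ n p → begin-strict
    ∣ seq x n ℚ.- seq z n ∣
      ≡⟨ cong ∣_∣ (telescope (seq x n) (seq y n) (seq z n)) ⟩
    ∣ (seq x n ℚ.- seq y n) ℚ.+ (seq y n ℚ.- seq z n) ∣
      ≤⟨ ℚ.∣p+q∣≤∣p∣+∣q∣ (seq x n ℚ.- seq y n) (seq y n ℚ.- seq z n) ⟩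
    ∣ seq x n ℚ.- seq y n ∣ ℚ.+ ∣ seq y n ℚ.- seq z n ∣
      <⟨ ℚ.+-mono-< (h n (ℕ.m⊔n≤o⇒m≤o M N p)) (k n (ℕ.m⊔n≤o⇒n≤o M N p)) ⟩
    ½ ℚ.* ε ℚ.+ ½ ℚ.* ε
      ≡⟨ halves ε ⟩
    ε ∎
  where
  open ℚ.≤-Reasoning
  open +-*-Solver
  telescope : ∀ a b c → a ℚ.- c ≡ (a ℚ.- b) ℚ.+ (b ℚ.- c)
  telescope = solve 3 (λ a b c → a :- c := (a :- b) :+ (b :- c)) refl

+-cong : Congruent₂ _≃_ _+_
+-cong {x} {x′} {y} {y′} x≃x′ y≃y′ ε 0<ε =
  let M , h = x≃x′ (½ ℚ.* ε) (half-pos ε 0<ε)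
      N , k = y≃y′ (½ ℚ.* ε) (half-pos ε 0<ε)
  in M ℕ.⊔ N , λ n p → begin-strict
    ∣ (seq x n ℚ.+ seq y n) ℚ.- (seq x′ n ℚ.+ seq y′ n) ∣
      ≡⟨ cong ∣_∣ (rearrange (seq x n) (seq y n) (seq x′ n) (seq y′ n)) ⟩
    ∣ (seq x n ℚ.- seq x′ n) ℚ.+ (seq y n ℚ.- seq y′ n) ∣
      ≤⟨ ℚ.∣p+q∣≤∣p∣+∣q∣ (seq x n ℚ.- seq x′ n) (seq y n ℚ.- seq y′ n) ⟩
    ∣ seq x n ℚ.- seq x′ n ∣ ℚ.+ ∣ seq y n ℚ.- seq y′ n ∣
      <⟨ ℚ.+-mono-< (h n (ℕ.m⊔n≤o⇒m≤o M N p)) (k n (ℕ.m⊔n≤o⇒n≤o M N p)) ⟩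
    ½ ℚ.* ε ℚ.+ ½ ℚ.* ε
      ≡⟨ halves ε ⟩
    ε ∎
  where
  open ℚ.≤-Reasoning
  open +-*-Solver
  rearrange : ∀ a b c d → (a ℚ.+ b) ℚ.- (c ℚ.+ d) ≡ (a ℚ.- c) ℚ.+ (b ℚ.- d)
  rearrange = solve 4 (λ a b c d →
    (a :+ b) :- (c :+ d) := (a :- c) :+ (b :- d)) refl

-‿cong : Congruent₁ _≃_ (-_)
-‿cong {x} {x′} x≃x′ ε 0<ε =
  let N , h = x≃x′ ε 0<ε
  in N , λ n N≤n → subst (ℚ._< ε)
       (trans (sym (ℚ.∣-p∣≡∣p∣ (seq x n ℚ.- seq x′ n)))
              (cong ∣_∣ (ℚ.neg-distrib-+ (seq x n) (ℚ.- seq x′ n))))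
       (h n N≤n)

-- The terms of `x` are eventually bounded by some `B`, so an error below `ε / B` in the other
-- factor suffices.
*-congʳ : ∀ x {y z} → y ≃ z → x * y ≃ x * z
*-congʳ x {y} {z} y≃z ε 0<ε =
  let B , 0<B , M , x≤B = bounded (seq x) (cauchy x)
      δ , 0<δ , Bδ≡ε = shrink B 0<B ε 0<ε
      N , h = y≃z δ 0<δ
  in M ℕ.⊔ N , λ n p → begin-strict
    ∣ seq x n ℚ.* seq y n ℚ.- seq x n ℚ.* seq z n ∣
      ≡⟨ cong ∣_∣ (factor (seq x n) (seq y n) (seq z n)) ⟩
    ∣ seq x n ℚ.* (seq y n ℚ.- seq z n) ∣
      <⟨ product-bound (seq x n) (seq y n ℚ.- seq z n) 0<B
           (x≤B n (ℕ.m⊔n≤o⇒m≤o M N p)) (h n (ℕ.m⊔n≤o⇒n≤o M N p)) ⟩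
    B ℚ.* δ
      ≡⟨ Bδ≡ε ⟩
    ε ∎
  where
  open ℚ.≤-Reasoning
  open +-*-Solver
  factor : ∀ a b c → a ℚ.* b ℚ.- a ℚ.* c ≡ a ℚ.* (b ℚ.- c)
  factor = solve 3 (λ a b c → a :* b :- a :* c := a :* (b :- c)) refl

*-comm : ∀ x y → x * y ≃ y * x
*-comm x y = ≡⇒≃ (x * y) (y * x) (λ n → ℚ.*-comm (seq x n) (seq y n))

*-cong : Congruent₂ _≃_ _*_
*-cong {x} {x′} {y} {y′} x≃x′ y≃y′ =
  ≃-trans {x * y} {x * y′} {x′ * y′} (*-congʳ x {y} {y′} y≃y′)
  (≃-trans {x * y′} {y′ * x} {x′ * y′} (*-comm x y′)
  (≃-trans {y′ * x} {y′ * x′} {x′ * y′} (*-congʳ y′ {x} {x′} x≃x′) (*-comm y′ x′)))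

ℝ-commutativeRing : CommutativeRing 0ℓ 0ℓ
ℝ-commutativeRing = record
  { Carrier = ℝ ; _≈_ = _≃_ ; _+_ = _+_ ; _*_ = _*_ ; -_ = -_ ; 0# = 0ℝ ; 1# = 1ℝ
  ; isCommutativeRing = record
    { isRing = record
      { +-isAbelianGroup = record
        { isGroup = record
          { isMonoid = record
            { isSemigroup = record
              { isMagma = record
                { isEquivalence = record
                  { refl = λ {x} → ≃-refl {x}
                  ; sym = λ {x} {y} → ≃-sym {x} {y}
                  ; trans = λ {x} {y} {z} → ≃-trans {x} {y} {z}
                  }
                ; ∙-cong = λ {x} {x′} {y} {y′} → +-cong {x} {x′} {y} {y′}
                }
              ; assoc = λ x y z → ≡⇒≃ ((x + y) + z) (x + (y + z))
                  (λ n → ℚ.+-assoc (seq x n) (seq y n) (seq z n))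
              }
            ; identity = (λ x → ≡⇒≃ (0ℝ + x) x (λ n → ℚ.+-identityˡ (seq x n)))
                       , (λ x → ≡⇒≃ (x + 0ℝ) x (λ n → ℚ.+-identityʳ (seq x n)))
            }
          ; inverse = (λ x → ≡⇒≃ (- x + x) 0ℝ (λ n → ℚ.+-inverseˡ (seq x n)))
                    , (λ x → ≡⇒≃ (x - x) 0ℝ (λ n → ℚ.+-inverseʳ (seq x n)))
          ; ⁻¹-cong = λ {x} {y} → -‿cong {x} {y}
          }
        ; comm = λ x y → ≡⇒≃ (x + y) (y + x) (λ n → ℚ.+-comm (seq x n) (seq y n))
        }
      ; *-cong = λ {x} {x′} {y} {y′} → *-cong {x} {x′} {y} {y′}
      ; *-assoc = λ x y z → ≡⇒≃ ((x * y) * z) (x * (y * z))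
          (λ n → ℚ.*-assoc (seq x n) (seq y n) (seq z n))
      ; *-identity = (λ x → ≡⇒≃ (1ℝ * x) x (λ n → ℚ.*-identityˡ (seq x n)))
                   , (λ x → ≡⇒≃ (x * 1ℝ) x (λ n → ℚ.*-identityʳ (seq x n)))
      ; distrib =
          (λ x y z → ≡⇒≃ (x * (y + z)) (x * y + x * z)
            (λ n → ℚ.*-distribˡ-+ (seq x n) (seq y n) (seq z n)))
        , (λ x y z → ≡⇒≃ ((y + z) * x) (y * x + z * x)
            (λ n → ℚ.*-distribʳ-+ (seq x n) (seq y n) (seq z n)))
      }
    ; *-comm = *-comm
    }
  }

-- At this instance `dot` and `_⊡_` agree by computation with `⟨_,_⟩` and `_·_`.
open LinearAlgebra ℝ-commutativeRing

-- Reciprocals and invertibility of reals.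

-- Junk value: the reciprocal of 0 is 0.
recip : ℚ → ℚ
recip q with q ℚ.≟ 0ℚ
... | yes _  = 0ℚ
... | no q≢0 = (1/ q) {{ℚ.≢-nonZero q≢0}}

recip-inverseˡ : ∀ q → q ≢ 0ℚ → recip q ℚ.* q ≡ 1ℚ
recip-inverseˡ q q≢0 with q ℚ.≟ 0ℚ
... | yes q≡0 = contradiction q≡0 q≢0
... | no q≢0′ = ℚ.*-inverseˡ q {{ℚ.≢-nonZero q≢0′}}

recip-inverseˡ-apart : ∀ {δ q} → 0ℚ ℚ.< δ → δ ℚ.≤ ∣ q ∣ → recip q ℚ.* q ≡ 1ℚ
recip-inverseˡ-apart {δ} {q} 0<δ δ≤∣q∣ = recip-inverseˡ q λ where
  refl → ℚ.<-irrefl refl (ℚ.<-≤-trans 0<δ δ≤∣q∣)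

-- Being bounded away from zero from some index on; the explicit bound `δ` controls the reciprocals.
Apart : ℝ → Set
Apart x = ∃[ δ ] (0ℚ ℚ.< δ × ∃[ N ] (∀ n → N ≤ n → δ ℚ.≤ ∣ seq x n ∣))

-- For late terms `a` and `b`, multiplying the difference of their reciprocals by `a` and `b` leaves
-- `b - a`. Both have absolute value at least `δ`, so bringing `∣ b - a ∣` below `δ * (δ * ε)` is
-- enough.
recip-cauchy : ∀ x → Apart x → Cauchy (recip ∘ seq x)
recip-cauchy x (δ , 0<δ , N , δ≤∣x∣) ε 0<ε =
  let M , h = cauchy x (δ ℚ.* (δ ℚ.* ε)) (*-pos (*-pos 0<ε))
  in N ℕ.⊔ M , λ m n p q →
  let a = seq x m
      b = seq x n
      d = recip a ℚ.- recip b
      δ≤∣a∣ = δ≤∣x∣ m (ℕ.m⊔n≤o⇒m≤o N M p)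
      δ≤∣b∣ = δ≤∣x∣ n (ℕ.m⊔n≤o⇒m≤o N M q)
  in ℚ.*-cancelˡ-<-nonNeg δ (ℚ.*-cancelˡ-<-nonNeg δ (begin-strict
    δ ℚ.* (δ ℚ.* ∣ d ∣)
      ≤⟨ ℚ.*-monoˡ-≤-nonNeg δ (scale d δ≤∣a∣) ⟩
    δ ℚ.* ∣ a ℚ.* d ∣
      ≤⟨ scale (a ℚ.* d) δ≤∣b∣ ⟩
    ∣ b ℚ.* (a ℚ.* d) ∣
      ≡⟨ cong ∣_∣ (trans (expand a b (recip a) (recip b))
           (cong₂ (λ u v → u ℚ.* b ℚ.- v ℚ.* a)
             (recip-inverseˡ-apart 0<δ δ≤∣a∣) (recip-inverseˡ-apart 0<δ δ≤∣b∣))) ⟩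
    ∣ 1ℚ ℚ.* b ℚ.- 1ℚ ℚ.* a ∣
      ≡⟨ cong₂ (λ u v → ∣ u ℚ.- v ∣) (ℚ.*-identityˡ b) (ℚ.*-identityˡ a) ⟩
    ∣ b ℚ.- a ∣
      <⟨ h n m (ℕ.m⊔n≤o⇒n≤o N M q) (ℕ.m⊔n≤o⇒n≤o N M p) ⟩
    δ ℚ.* (δ ℚ.* ε) ∎))
  where
  open ℚ.≤-Reasoning
  open +-*-Solver
  instance
    δ-pos : ℚ.Positive δ
    δ-pos = ℚ.positive 0<δ
    δ-nonNeg : ℚ.NonNegative δ
    δ-nonNeg = ℚ.pos⇒nonNeg δ
  *-pos : ∀ {η} → 0ℚ ℚ.< η → 0ℚ ℚ.< δ ℚ.* η
  *-pos {η} 0<η = subst (ℚ._< δ ℚ.* η) (ℚ.*-zeroʳ δ) (ℚ.*-monoʳ-<-pos δ 0<η)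
  scale : ∀ {a} b → δ ℚ.≤ ∣ a ∣ → δ ℚ.* ∣ b ∣ ℚ.≤ ∣ a ℚ.* b ∣
  scale {a} b δ≤∣a∣ = subst (δ ℚ.* ∣ b ∣ ℚ.≤_) (sym (ℚ.∣p*q∣≡∣p∣*∣q∣ a b))
    (ℚ.*-monoʳ-≤-nonNeg ∣ b ∣ {{ℚ.∣-∣-nonNeg b}} δ≤∣a∣)
  expand : ∀ a b u v →
    b ℚ.* (a ℚ.* (u ℚ.- v)) ≡ u ℚ.* a ℚ.* b ℚ.- v ℚ.* b ℚ.* a
  expand = solve 4 (λ a b u v →
    b :* (a :* (u :- v)) := u :* a :* b :- v :* b :* a) refl

-- Zero terms, hence junk reciprocals, can occur only before `N`; from there on the termwise product
-- is exactly `1ℚ`.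
apart⇒invertible : ∀ {x} → Apart x → Invertible x
apart⇒invertible {x} x#0@(δ , 0<δ , N , δ≤∣x∣) =
  mkℝ (recip ∘ seq x) (recip-cauchy x x#0) , λ ε 0<ε → N , λ n N≤n →
    subst (ℚ._< ε)
      (cong (λ u → ∣ u ℚ.- 1ℚ ∣) (sym (recip-inverseˡ-apart 0<δ (δ≤∣x∣ n N≤n))))
      0<ε

-- Compare the value at one sufficiently late index with ε / 2.
small-or-apart : ∀ x ε → 0ℚ ℚ.< ε →
  ∃[ N ] (∀ n → N ≤ n → ∣ seq x n ∣ ℚ.< ε) ⊎ Apart x
small-or-apart x ε 0<ε = decide (∣ seq x N ∣ ℚ.<? ½ ℚ.* ε)
  where
  open ℚ.≤-Reasoning
  open +-*-Solver
  0<½ε = half-pos ε 0<ε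
  -- A quarter of `ε`: a term below `ε / 2` at `N` keeps later ones below `ε / 2 + η < ε`, and a
  -- term of at least `ε / 2` keeps them at least `η`.
  η = ½ ℚ.* (½ ℚ.* ε)
  0<η = half-pos (½ ℚ.* ε) 0<½ε
  N = proj₁ (cauchy x η 0<η)
  close : ∀ m n → N ≤ m → N ≤ n → ∣ seq x m ℚ.- seq x n ∣ ℚ.< η
  close = proj₂ (cauchy x η 0<η)
  near : ∀ m n → N ≤ m → N ≤ n → ∣ seq x m ∣ ℚ.< ∣ seq x n ∣ ℚ.+ η
  near m n N≤m N≤n = begin-strict
    ∣ seq x m ∣
      ≡⟨ cong ∣_∣ (solve 2 (λ a b → a := b :+ (a :- b)) refl (seq x m) (seq x n)) ⟩
    ∣ seq x n ℚ.+ (seq x m ℚ.- seq x n) ∣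
      ≤⟨ ℚ.∣p+q∣≤∣p∣+∣q∣ (seq x n) (seq x m ℚ.- seq x n) ⟩
    ∣ seq x n ∣ ℚ.+ ∣ seq x m ℚ.- seq x n ∣
      <⟨ ℚ.+-monoʳ-< ∣ seq x n ∣ (close m n N≤m N≤n) ⟩
    ∣ seq x n ∣ ℚ.+ η ∎
  η<½ε : η ℚ.< ½ ℚ.* ε
  η<½ε = begin-strict
    η           ≡⟨ ℚ.+-identityʳ η ⟨
    η ℚ.+ 0ℚ    <⟨ ℚ.+-monoʳ-< η 0<η ⟩
    η ℚ.+ η     ≡⟨ halves (½ ℚ.* ε) ⟩
    ½ ℚ.* ε     ∎
  decide : _ → _
  decide (yes small) = inj₁ (N , λ n N≤n → begin-strict
    ∣ seq x n ∣          <⟨ near n N N≤n ℕ.≤-refl ⟩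
    ∣ seq x N ∣ ℚ.+ η    <⟨ ℚ.+-mono-< small η<½ε ⟩
    ½ ℚ.* ε ℚ.+ ½ ℚ.* ε  ≡⟨ halves ε ⟩
    ε                    ∎)
  decide (no large) = inj₂ (η , 0<η , N , λ n N≤n → ℚ.≮⇒≥ λ x<η → large (begin-strict
    ∣ seq x N ∣        <⟨ near N n ℕ.≤-refl N≤n ⟩
    ∣ seq x n ∣ ℚ.+ η  <⟨ ℚ.+-monoˡ-< η x<η ⟩
    η ℚ.+ η            ≡⟨ halves (½ ℚ.* ε) ⟩
    ½ ℚ.* ε            ∎))

-- For each `ε` the alternative `Apart x` would yield an inverse, so `x` is eventually below `ε`.
noninvertible⇒≃0 : ∀ {x} → ¬ Invertible x → x ≃ 0ℝ
noninvertible⇒≃0 {x} ¬inv ε 0<ε with small-or-apart x ε 0<ε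
... | inj₂ x#0 = contradiction (apart⇒invertible {x} x#0) ¬inv
... | inj₁ (N , small) = N , λ n N≤n →
  subst (ℚ._< ε) (cong ∣_∣ (sym (ℚ.+-identityʳ (seq x n)))) (small n N≤n)

-- Definiteness of the dot product.

0≤p*p : ∀ p → 0ℚ ℚ.≤ p ℚ.* p
0≤p*p p with ℚ.≤-total 0ℚ p
... | inj₁ 0≤p = subst (ℚ._≤ p ℚ.* p) (ℚ.*-zeroʳ p)
  (ℚ.*-monoˡ-≤-nonNeg p {{ℚ.nonNegative 0≤p}} 0≤p)
... | inj₂ p≤0 = subst (ℚ._≤ p ℚ.* p) (ℚ.*-zeroʳ p)
  (ℚ.*-monoˡ-≤-nonPos p {{ℚ.nonPositive p≤0}} p≤0)

module _ where
  open ℚ.≤-Reasoning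

  dot-self-nonNeg : ∀ {n} (x : Vector ℝ n) k → 0ℚ ℚ.≤ seq ⟨ x , x ⟩ k
  dot-self-nonNeg {zero} x k = ℚ.≤-refl
  dot-self-nonNeg {suc n} x k =
    ℚ.+-mono-≤ (0≤p*p (seq (x zero) k)) (dot-self-nonNeg (tail x) k)

  square≤dot-self : ∀ {n} (x : Vector ℝ n) i k →
    seq (x i) k ℚ.* seq (x i) k ℚ.≤ seq ⟨ x , x ⟩ k
  square≤dot-self x zero k = begin
    seq (x zero) k ℚ.* seq (x zero) k
      ≡⟨ ℚ.+-identityʳ _ ⟨
    seq (x zero) k ℚ.* seq (x zero) k ℚ.+ 0ℚ
      ≤⟨ ℚ.+-monoʳ-≤ (seq (x zero) k ℚ.* seq (x zero) k) (dot-self-nonNeg (tail x) k) ⟩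
    seq ⟨ x , x ⟩ k ∎
  square≤dot-self x (suc i) k = begin
    seq (x (suc i)) k ℚ.* seq (x (suc i)) k
      ≤⟨ square≤dot-self (tail x) i k ⟩
    seq ⟨ tail x , tail x ⟩ k
      ≡⟨ ℚ.+-identityˡ _ ⟨
    0ℚ ℚ.+ seq ⟨ tail x , tail x ⟩ k
      ≤⟨ ℚ.+-monoˡ-≤ (seq ⟨ tail x , tail x ⟩ k) (0≤p*p (seq (x zero) k)) ⟩
    seq ⟨ x , x ⟩ k ∎

  -- Argued term by term in the rationals: each square is at most the whole sum, so a term with
  -- `ε ≤ ∣ a ∣` would contradict the sum being below `ε * ε`.
  dot-definite : ∀ {n} (x : Vector ℝ n) → ⟨ x , x ⟩ ≃ 0ℝ → ∀ i → x i ≃ 0ℝ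
  dot-definite x xx≃0 i ε 0<ε =
    let N , h = xx≃0 (ε ℚ.* ε) 0<εε
    in N , λ k N≤k → let a = seq (x i) k in
      ℚ.≰⇒> λ ε≤∣a-0∣ →
      let ε≤∣a∣ = subst (ε ℚ.≤_) (cong ∣_∣ (ℚ.+-identityʳ a)) ε≤∣a-0∣
      in ℚ.<-irrefl refl (begin-strict
        ε ℚ.* ε
          ≤⟨ ℚ.*-monoˡ-≤-nonNeg ε ε≤∣a∣ ⟩
        ε ℚ.* ∣ a ∣
          ≤⟨ ℚ.*-monoʳ-≤-nonNeg ∣ a ∣ {{ℚ.∣-∣-nonNeg a}} ε≤∣a∣ ⟩
        ∣ a ∣ ℚ.* ∣ a ∣
          ≡⟨ ℚ.∣p*q∣≡∣p∣*∣q∣ a a ⟨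
        ∣ a ℚ.* a ∣
          ≡⟨ ℚ.0≤p⇒∣p∣≡p (0≤p*p a) ⟩
        a ℚ.* a
          ≤⟨ square≤dot-self x i k ⟩
        seq ⟨ x , x ⟩ k
          ≡⟨ ℚ.0≤p⇒∣p∣≡p (dot-self-nonNeg x k) ⟨
        ∣ seq ⟨ x , x ⟩ k ∣
          ≡⟨ cong ∣_∣ (ℚ.+-identityʳ (seq ⟨ x , x ⟩ k)) ⟨
        ∣ seq ⟨ x , x ⟩ k ℚ.- 0ℚ ∣
          <⟨ h k N≤k ⟩
        ε ℚ.* ε ∎)
    where
    instance
      ε-pos : ℚ.Positive ε
      ε-pos = ℚ.positive 0<ε
      ε-nonNeg : ℚ.NonNegative ε
      ε-nonNeg = ℚ.pos⇒nonNeg ε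
    0<εε : 0ℚ ℚ.< ε ℚ.* ε
    0<εε = subst (ℚ._< ε ℚ.* ε) (ℚ.*-zeroʳ ε) (ℚ.*-monoʳ-<-pos ε 0<ε)

open Projection (λ {x} → noninvertible⇒≃0 {x}) dot-definite

-- Main eigenvalues and walk matrices.

adjacencyMatrix-symmetric : ∀ {n} (G : Graph n) → Symm (adjacencyMatrix G)
adjacencyMatrix-symmetric G i j with Graph._~?_ G i j | Graph._~?_ G j i
... | yes _   | yes _   = ≃-refl {1ℝ}
... | no _    | no _    = ≃-refl {0ℝ}
... | yes i~j | no j≁i  = contradiction (Graph.~-sym G i~j) j≁i
... | no i≁j  | yes j~i = contradiction (Graph.~-sym G j~i) i≁j

-- `shared-eigenvector` identifies eigenvalues only up to `≃`, so membership has to be carried along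
-- it; the eigenvector is kept.
mainEigenvalue-resp : ∀ {n} (H : Graph n) {μ ν} → μ ≃ ν →
  ν ∈ MainEigenvalue H → μ ∈ MainEigenvalue H
mainEigenvalue-resp H {μ} {ν} μ≃ν (x , (x≄0 , Bx≃νx) , x∤j) =
  x , (x≄0 , λ i → ≃-trans {(adjacencyMatrix H · x) i} {ν * x i} {μ * x i} (Bx≃νx i)
        (*-cong {ν} {μ} {x i} {x i} (≃-sym {μ} {ν} μ≃ν) (≃-refl {x i}))) , x∤j

-- Stated with a single inclusion so that it applies with `G` and `H` exchanged; the double negation
-- comes from `projection-exists`.
main-eigenvalue-transfers : ∀ {n} (G H : Graph n) →
  (∀ {v} → v ∈ PrincipalMainEigenvector G → v ∈ PrincipalMainEigenvector H) →
  (adjacencyMatrix G · 𝐣) ≃ᵛ (adjacencyMatrix H · 𝐣) →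
  ∀ {μ} → μ ∈ MainEigenvalue G → ¬ ¬ (μ ∈ MainEigenvalue H)
main-eigenvalue-transfers G H G⊆H Aj≃Bj {μ} μ-main@(x , (_ , Ax≃μx) , x∤j) μ∉H =
  projection-exists (eigenspace-isSubspace A μ) 𝐣 λ (v , Av≃μv , v-proj) →
  let ν , ν-main , Bv≃νv , _ = G⊆H {v}
        (μ , μ-main , Av≃μv , λ s s∈ → dot-⊟ᵛ≈0 𝐣 v s (≃-sym {⟨ v , s ⟩} {⟨ 𝐣 , s ⟩} (v-proj s s∈)))
      vj≄0 : ¬ (⟨ v , 𝐣 ⟩ ≃ 0ℝ)
      -- Since `⟨ v , 𝐣 ⟩` equals `⟨ v , v ⟩`, its vanishing would make `v` zero, and then `x` would
      -- be orthogonal to `𝐣`.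
      vj≄0 vj≃0 = x∤j (begin
        ⟨ x , 𝐣 ⟩  ≈⟨ dot-comm x 𝐣 ⟩
        ⟨ 𝐣 , x ⟩  ≈⟨ v-proj x Ax≃μx ⟨
        ⟨ v , x ⟩  ≈⟨ dot-zeroˡ x (dot-definite v (begin
          ⟨ v , v ⟩  ≈⟨ v-proj v Av≃μv ⟩
          ⟨ 𝐣 , v ⟩  ≈⟨ dot-comm 𝐣 v ⟩
          ⟨ v , 𝐣 ⟩  ≈⟨ vj≃0 ⟩
          0ℝ         ∎)) ⟩
        0ℝ         ∎)
  -- Cancelling needs an inverse of `⟨ v , 𝐣 ⟩`. If there were one, `μ` would be a main eigenvalue
  -- of `H`, against `μ∉H`; so there is none, and `⟨ v , 𝐣 ⟩` would be zero.
  in vj≄0 (noninvertible⇒≃0 {⟨ v , 𝐣 ⟩} λ vj-inv → μ∉H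
       (mainEigenvalue-resp H {μ} {ν}
         (shared-eigenvector {A = A} {B} {μ} {ν} {𝐣} {v}
           (adjacencyMatrix-symmetric G) (adjacencyMatrix-symmetric H)
           Aj≃Bj Av≃μv Bv≃νv vj-inv)
         ν-main))
  where
  open SetoidReasoning (CommutativeRing.setoid ℝ-commutativeRing)
  A = adjacencyMatrix G
  B = adjacencyMatrix H

proposition5p3 : (n : ℕ) (G H : Graph n) →
    PrincipalMainEigenvector G ≐ PrincipalMainEigenvector H →
    Differ (MainEigenvalue G) (MainEigenvalue H) →
    (k : ℕ) → 2 ≤ k → ¬ (walkMatrix G k ≃ᵐ walkMatrix H k)
proposition5p3 n G H (G⊆H , H⊆G) (μ , differ) (suc (suc k)) (s≤s (s≤s _)) W≃W = refute differ
  where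
  Aj≃Bj : (adjacencyMatrix G · 𝐣) ≃ᵛ (adjacencyMatrix H · 𝐣)
  -- Columns count from 0, so index 1 is the image of `𝐣`; `2 ≤ k` guarantees that this column
  -- exists.
  Aj≃Bj i = W≃W i (suc zero)
  refute : ¬ ((μ ∈ MainEigenvalue G × μ ∉ MainEigenvalue H) ⊎
              (μ ∉ MainEigenvalue G × μ ∈ MainEigenvalue H))
  refute (inj₁ (μ∈G , μ∉H)) = main-eigenvalue-transfers G H G⊆H Aj≃Bj {μ} μ∈G μ∉H
  refute (inj₂ (μ∉G , μ∈H)) = main-eigenvalue-transfers H G H⊆G
    (λ i → ≃-sym {(adjacencyMatrix G · 𝐣) i} {(adjacencyMatrix H · 𝐣) i} (Aj≃Bj i)) {μ} μ∈H μ∉G
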